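{- Let $\theta_1=\phi_1(D)$ and $\theta_2=\phi_2(D)$ be delta operators with poweroids $x^{\{n\}_1}$ and $x^{\{n\}_2}$ respectively, let $\eta_1=\phi_1^{ -1}(D)$, $\eta_2=\phi_2^{ -1}(D)$, and let $x^{\{n\}_{12}}$ be the poweroids of the composite delta operator $\phi_{12}(D)=(\phi_2\circ\phi_1)(D)=\phi_2(\phi_1(D))$. Then $$e^{x\,\phi_1^{ -1}(\eta_2)}=e^{x\eta_1}\,e^{0_1\cdot\eta_2},$$ and, for every integer $n\ge0$, $$x^{\{n\}_{12}}=e^{x\eta_1}\,e^{0_1\cdot\eta_2}\,0_2^n=e^{x\eta_1}\,0_1^{\{n\}_2}=x^{\{n\}_2}\Big|_{x^i\to x^{\{i\}_1}},$$ i.e. $x^{\{n\}_{12}}$ is obtained from the polynomial $x^{\{n\}_2}$ by replacing each power $x^i$ by the poweroid $x^{\{i\}_1}$.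
   Context: Work with polynomials in one variable (real or complex coefficients); $D$ is differentiation. A delta operator is $\theta=\phi(D)$, where $\phi(t)=\sum_{\nu\ge1}k_\nu t^\nu$ is a formal power series with $k_1=1$; $\phi^{ -1}$ is its compositional inverse. The poweroids $x^{\{n\}}$ of $\theta$ are the unique polynomials with $x^{\{0\}}=1$, $\theta x^{\{n\}}=n\,x^{\{n-1\}}$ for $n\ge1$, and $x^{\{n\}}|_{x=0}=0$ for $n\ge1$. For a formal power series $f$ and polynomial $h$, $f(D)h(0)$ denotes $(f(D_z)h(z))|_{z=0}$; in $e^{x\eta}0^n$ the operator $\eta$ acts on $z^n$, then $z=0$, with $x$ a parameter. The symbols $0_1,0_2$ are two independent such variables (set to $0$ after the operators act): $\eta_1$ acts on powers of $0_1$ and $\eta_2$ acts on powers of $0_2$. Thus $e^{x\eta_1}e^{0_1\cdot\eta_2}$ is the power series in $\eta_2$ given by $\sum_{\nu\ge0}\big(e^{x\eta_1}0_1^\nu\big)\,\eta_2^\nu/\nu!$, and $e^{x\eta_1}0_1^{\{n\}_2}=\big(e^{x\phi_1^{ -1}(D_z)}z^{\{n\}_2}\big)|_{z=0}$. -}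

module Defs where

open import Algebra.Bundles using (CommutativeRing; RawSemiring; Semiring)
open import Data.Fin.Base using (toℕ)
open import Data.List.Base using (List; []; _∷_; map; length; lookup)
open import Data.Nat.Base as ℕ using (ℕ; zero; suc; _∸_)
open import Level using (_⊔_)
import Algebra.Definitions.RawSemiring as RawSemiringOps

-- Formal power series are sequences of coefficients, and polynomials are lists
-- of coefficients in increasing degree, in which trailing zeros are allowed.
-- Both are taken over a raw semiring, so that they can be used over K and over
-- K[x] alike.

module PowerSeries {c ℓ} (R : RawSemiring c ℓ) where

  open RawSemiring R
  open RawSemiringOps R using (sum)

  Series : Set c
  Series = ℕ → Carrier

  infix 4 _≈ˢ_
  _≈ˢ_ : Series → Series → Set ℓ
  f ≈ˢ g = ∀ n → f n ≈ g n

  constˢ : Carrier → Series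
  constˢ a zero    = a
  constˢ a (suc n) = 0#

  t : Series
  t zero          = 0#
  t (suc zero)    = 1#
  t (suc (suc n)) = 0#

  infixl 7 _*ˢ_
  _*ˢ_ : Series → Series → Series
  (f *ˢ g) n = sum {suc n} λ i → f (toℕ i) * g (n ∸ toℕ i)

  seriesRawSemiring : RawSemiring c ℓ
  seriesRawSemiring = record
    { Carrier = Series
    ; _≈_     = _≈ˢ_
    ; _+_     = λ f g n → f n + g n
    ; _*_     = _*ˢ_
    ; 0#      = constˢ 0#
    ; 1#      = constˢ 1#
    }

  open RawSemiringOps seriesRawSemiring using () renaming (_^_ to _^ˢ_)

  -- The substitution f(g(t)).  It is only meaningful when g has zero constant
  -- term: then gᵏ has no term of degree n < k, so the coefficient of tⁿ in
  -- Σₖ fₖ gᵏ only involves k ≤ n.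
  infixr 9 _∘ˢ_
  _∘ˢ_ : Series → Series → Series
  (f ∘ˢ g) n = sum {suc n} λ k → f (toℕ k) * (g ^ˢ toℕ k) n

module Polynomials {c ℓ} (R : RawSemiring c ℓ) where

  open RawSemiring R
  open RawSemiringOps R using (_×_)
  open PowerSeries R using (Series)

  Poly : Set c
  Poly = List Carrier

  coeff : Poly → ℕ → Carrier
  coeff []      n       = 0#
  coeff (a ∷ p) zero    = a
  coeff (a ∷ p) (suc n) = coeff p n

  infix 4 _≈ᵖ_
  _≈ᵖ_ : Poly → Poly → Set ℓ
  p ≈ᵖ q = ∀ n → coeff p n ≈ coeff q n

  infixl 6 _+ᵖ_
  _+ᵖ_ : Poly → Poly → Poly
  []      +ᵖ q       = q
  (a ∷ p) +ᵖ []      = a ∷ p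
  (a ∷ p) +ᵖ (b ∷ q) = a + b ∷ p +ᵖ q

  infixr 7 _·_
  _·_ : Carrier → Poly → Poly
  a · p = map (a *_) p

  infixl 7 _*ᵖ_
  _*ᵖ_ : Poly → Poly → Poly
  []      *ᵖ q = []
  (a ∷ p) *ᵖ q = a · q +ᵖ (0# ∷ p *ᵖ q)

  constᵖ : Carrier → Poly
  constᵖ a = a ∷ []

  var : Poly
  var = 0# ∷ 1# ∷ []

  polyRawSemiring : RawSemiring c ℓ
  polyRawSemiring = record
    { Carrier = Poly
    ; _≈_     = _≈ᵖ_
    ; _+_     = _+ᵖ_
    ; _*_     = _*ᵖ_
    ; 0#      = []
    ; 1#      = constᵖ 1#
    }

  open RawSemiringOps polyRawSemiring using () renaming (sum to sumᵖ)

  eval : Poly → Carrier → Carrier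
  eval []      a = 0#
  eval (b ∷ p) a = b + a * eval p a

  weightFrom : ℕ → Poly → Poly
  weightFrom n []      = []
  weightFrom n (a ∷ p) = n × a ∷ weightFrom (suc n) p

  D : Poly → Poly
  D []      = []
  D (a ∷ p) = weightFrom 1 p

  D^ : ℕ → Poly → Poly
  D^ zero    p = p
  D^ (suc n) p = D (D^ n p)

  -- f(D) h = Σ_ν f_ν D^ν h; the terms with ν ≥ length h vanish.
  _⟨D⟩_ : Series → Poly → Poly
  f ⟨D⟩ h = sumᵖ {length h} λ ν → f (toℕ ν) · D^ (toℕ ν) h

  -- The polynomial obtained from p by replacing each power xⁱ by q i.
  replacePowers : Poly → (ℕ → Poly) → Poly
  replacePowers p q = sumᵖ {length p} λ i → lookup p i · q (toℕ i)

module _ {c ℓ} (K : CommutativeRing c ℓ) where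

  open CommutativeRing K
  open Semiring semiring using (rawSemiring)
  open RawSemiringOps rawSemiring using (_×_)

  record PositiveIntegersInvertible : Set (c ⊔ ℓ) where
    field
      1/suc         : ℕ → Carrier
      1/suc-inverse : ∀ n → (suc n × 1#) * 1/suc n ≈ 1#

-- K plays the role of ℝ or ℂ; all that is used of them is that they are
-- commutative rings in which 1, 2, 3, … are invertible.

module Poweroids {c ℓ} (K : CommutativeRing c ℓ)
                 (inv : PositiveIntegersInvertible K) where

  open CommutativeRing K
  open PositiveIntegersInvertible inv
  open Semiring semiring using (rawSemiring)
  open RawSemiringOps rawSemiring using (_×_)
  open PowerSeries rawSemiring public
  open Polynomials rawSemiring public

  1/_! : ℕ → Carrier
  1/ zero  ! = 1#
  1/ suc n ! = 1/suc n * 1/ n !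

  record DeltaSeries : Set (c ⊔ ℓ) where
    field
      series   : Series
      constant : series 0 ≈ 0#
      linear   : series 1 ≈ 1#

  open DeltaSeries public

  infixr 9 _∘ᵟ_
  _∘ᵟ_ : DeltaSeries → DeltaSeries → DeltaSeries
  φ ∘ᵟ χ = record
    { series   = series φ ∘ˢ series χ
    ; constant = trans (+-identityʳ _) (trans (*-identityʳ _) (constant φ))
    ; linear   =
        trans (+-cong (zeroʳ _) (+-identityʳ _))
          (trans (+-identityˡ _)
            (trans (*-cong (linear φ) χ¹-linear) (*-identityˡ _)))
    }
    where
    -- The coefficient of t in χ¹, which unfolds to the product χ *ˢ 1.
    χ¹-linear : series χ 0 * 0# + (series χ 1 * 1# + 0#) ≈ 1#
    χ¹-linear =
      trans (+-cong (zeroʳ _) (+-identityʳ _))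
        (trans (+-identityˡ _) (trans (*-identityʳ _) (linear χ)))

  record IsCompositionalInverse (φ : DeltaSeries) (ψ : Series) : Set ℓ where
    field
      constant-zero : ψ 0 ≈ 0#
      inverseʳ      : series φ ∘ˢ ψ ≈ˢ t
      inverseˡ      : ψ ∘ˢ series φ ≈ˢ t

  record IsPoweroids (φ : DeltaSeries) (p : ℕ → Poly) : Set ℓ where
    field
      p-zero  : p 0 ≈ᵖ constᵖ 1#
      lowers  : ∀ n → series φ ⟨D⟩ p (suc n) ≈ᵖ (suc n × 1#) · p n
      at-zero : ∀ n → eval (p (suc n)) 0# ≈ 0#

  module K[x] where
    open RawSemiring polyRawSemiring public
    open PowerSeries polyRawSemiring public
    open Polynomials polyRawSemiring public

  -- The parameter x is the variable of K[x], so operators such as e^{xη} are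
  -- power series in D = D_z with coefficients in K[x], acting on K[x][z].

  liftˢ : Series → K[x].Series
  liftˢ f n = constᵖ (f n)

  -- z ↦ z, K[z] → K[x][z]; note that this is not the inclusion of K[x] as
  -- constants.
  liftᵖ : Poly → K[x].Poly
  liftᵖ = map constᵖ

  -- e^{xη} for η = ψ(D), as the series Σ_k (xψ)ᵏ/k!.
  e^x_ : Series → K[x].Series
  e^x ψ = liftˢ 1/_! K[x].∘ˢ λ n → var *ᵖ constᵖ (ψ n)

  -- f h(0) = (f(D_z) h(z)) at z = 0.
  _at-0_ : K[x].Series → Poly → Poly
  f at-0 h = K[x].eval (f K[x].⟨D⟩ liftᵖ h) K[x].0#

  infixr 8 z^_
  z^_ : ℕ → Poly
  z^ n = var ^ n
    where open RawSemiringOps polyRawSemiring using (_^_)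

  -- e^{xη₁} e^{0₁·η₂} = Σ_ν (e^{xη₁} 0₁^ν) η₂^ν/ν!, expressed as a series in D
  -- by substituting η₂ = ψ₂(D).
  e^x_e^0·_ : Series → Series → K[x].Series
  e^x ψ₁ e^0· ψ₂ = (λ ν → 1/ ν ! · ((e^x ψ₁) at-0 (z^ ν))) K[x].∘ˢ liftˢ ψ₂

{-# OPTIONS --safe #-}
-- Let ⟪f , h⟫ = (f(D) h)(0) = Σₖ fₖ k! hₖ.  Moving one factor φ at a time onto the
-- polynomial, ⟪φᵐ , p n⟫ = n! δₙₘ for the poweroids p of φ.  Since tʲ = ψ(φ(t))ʲ,
-- expanding in powers of φ gives j! [xʲ] p n = ⟪tʲ , p n⟫ = n! [tⁿ] ψʲ, that is,
-- p n = e^{xψ(D)} 0ⁿ.  As e^{xψ} has xʲ-coefficient ψʲ/j!, all the identities then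
-- follow from two facts: composition with ψ₂ is multiplicative, so that
-- (ψ₁ ∘ ψ₂)ʲ = ψ₁ʲ ∘ ψ₂, and ψ₁ ∘ ψ₂ is inverse to φ₂ ∘ φ₁.
module Submission where

open import Algebra.Bundles using (CommutativeRing; CommutativeSemiring; RawSemiring; Semiring)
open import Data.Fin.Base as Fin using (toℕ)
open import Data.List.Base using ([]; _∷_; length; lookup)
open import Data.List.Properties using (length-map)
open import Data.Nat.Base as ℕ using (ℕ; zero; suc; _∸_; _≤_; _<_; z≤n; s≤s; z<s; s<s)
open import Data.Nat.Properties as ℕ using (≤-trans; m∸n≤m; m≤m+n; m≤n+m)
open import Data.Product.Base using (_×_; _,_)
open import Function.Base using (_∘_)
open import Level using (_⊔_)
open import Relation.Binary.PropositionalEquality.Core as ≡ using (_≡_)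
import Algebra.Definitions.RawSemiring as RawSemiringOps
import Algebra.Properties.CommutativeMonoid.Sum as CommutativeMonoidSum
import Algebra.Properties.CommutativeSemigroup as CommutativeSemigroupProperties
import Algebra.Properties.Semiring.Sum as SemiringSum
import Relation.Binary.Reasoning.Setoid as SetoidReasoning
open import Defs

-- Two things shape the formal proof. Every sum is finite, with a cutoff dictated by its definition:
-- n + 1 for a composition in degree n, the length of a list for a polynomial, and equal polynomials
-- may have different lengths. Sums can be exchanged only after all inner ones are given a common
-- cutoff; the vanishing of hᵏ below degree k, for h without constant term, provides it. The
-- exponentials live over K[x], yet the laws of series are applied over K alone: the coefficient of
-- xʲ turns an exponential into a series over K. Moving a factor φ onto the polynomial works
-- because, in the weighted coefficients k! hₖ, differentiation is a plain shift, so that f(D) is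
-- the transpose of multiplication by f. Division by factorials is postponed until p n is compared
-- with e^{xψ}.

-- Formal power series: finite sums, products, composition.

module SeriesProperties {c ℓ} (S : CommutativeSemiring c ℓ) where

  open CommutativeSemiring S
  open RawSemiringOps rawSemiring using (sum) renaming (_×_ to _×ᶜ_)
  open PowerSeries rawSemiring
  open RawSemiringOps seriesRawSemiring using () renaming (_^_ to _^ˢ_)
  open CommutativeMonoidSum +-commutativeMonoid using (∑-distrib-+; ∑-comm)
  open SemiringSum semiring using (*-distribˡ-sum; *-distribʳ-sum)
  open CommutativeSemigroupProperties *-commutativeSemigroup using (x∙yz≈y∙xz)
  open SetoidReasoning setoid

  -- Finite sums

  Σ< : ℕ → (ℕ → Carrier) → Carrier
  Σ< n F = sum {n} λ i → F (toℕ i)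

  Σ<-cong : ∀ n {F G} → (∀ k → k < n → F k ≈ G k) → Σ< n F ≈ Σ< n G
  Σ<-cong zero    F≈G = refl
  Σ<-cong (suc n) F≈G =
    +-cong (F≈G 0 z<s) (Σ<-cong n λ k k<n → F≈G (suc k) (s<s k<n))

  Σ<-zero : ∀ n {F} → (∀ k → k < n → F k ≈ 0#) → Σ< n F ≈ 0#
  Σ<-zero zero    F≈0 = refl
  Σ<-zero (suc n) F≈0 =
    trans (+-cong (F≈0 0 z<s) (Σ<-zero n λ k k<n → F≈0 (suc k) (s<s k<n)))
          (+-identityʳ 0#)

  Σ<-+ : ∀ n F G → Σ< n (λ k → F k + G k) ≈ Σ< n F + Σ< n G
  Σ<-+ n F G = ∑-distrib-+ {n} (λ i → F (toℕ i)) (λ i → G (toℕ i))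

  *-Σ< : ∀ n a F → a * Σ< n F ≈ Σ< n (λ k → a * F k)
  *-Σ< n a F = *-distribˡ-sum {n} a (λ i → F (toℕ i))

  Σ<-* : ∀ n a F → Σ< n F * a ≈ Σ< n (λ k → F k * a)
  Σ<-* n a F = *-distribʳ-sum {n} a (λ i → F (toℕ i))

  Σ<-extend : ∀ {m n} (F : Series) → m ≤ n → (∀ k → m ≤ k → F k ≈ 0#) → Σ< n F ≈ Σ< m F
  Σ<-extend {n = n} F z≤n F≈0 = Σ<-zero n λ k _ → F≈0 k z≤n
  Σ<-extend F (s≤s m≤n) F≈0 =
    +-congˡ (Σ<-extend (F ∘ suc) m≤n λ k m≤k → F≈0 (suc k) (s≤s m≤k))

  -- Associativity of row vector times matrix times column vector, (aG)b = a(Gb). Composing with a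
  -- series is multiplication by the matrix of its powers, so this is the exchange of sums needed
  -- throughout.
  Σ<-interchange : ∀ M N (a : Series) (G : ℕ → Series) (b : Series) →
    Σ< M (λ k → Σ< N (λ m → a m * G m k) * b k) ≈
    Σ< N (λ m → a m * Σ< M (λ k → G m k * b k))
  Σ<-interchange M N a G b = begin
    Σ< M (λ k → Σ< N (λ m → a m * G m k) * b k)
      ≈⟨ Σ<-cong M (λ k _ → Σ<-* N (b k) (λ m → a m * G m k)) ⟩
    Σ< M (λ k → Σ< N (λ m → a m * G m k * b k))
      ≈⟨ ∑-comm {M} {N} (λ i j → a (toℕ j) * G (toℕ j) (toℕ i) * b (toℕ i)) ⟩
    Σ< N (λ m → Σ< M (λ k → a m * G m k * b k))
      ≈⟨ Σ<-cong N (λ m _ → Σ<-cong M (λ k _ → *-assoc (a m) (G m k) (b k))) ⟩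
    Σ< N (λ m → Σ< M (λ k → a m * (G m k * b k)))
      ≈⟨ Σ<-cong N (λ m _ → *-Σ< M (a m) (λ k → G m k * b k)) ⟨
    Σ< N (λ m → a m * Σ< M (λ k → G m k * b k)) ∎

  -- Both cutoffs are compared with m + n, so neither has to be known to be the smaller. This
  -- matters for polynomials, whose lengths may include trailing zeros.
  Σ<-agree : ∀ m n (F : Series) → (∀ k → m ≤ k → F k ≈ 0#) → (∀ k → n ≤ k → F k ≈ 0#) →
             Σ< m F ≈ Σ< n F
  Σ<-agree m n F F≈0-from-m F≈0-from-n =
    trans (sym (Σ<-extend F (m≤m+n m n) F≈0-from-m)) (Σ<-extend F (m≤n+m n m) F≈0-from-n)

  -- As a series in its second argument, `δ m` is the monomial tᵐ, hence the operator Dᵐ.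
  δ : ℕ → Series
  δ zero    zero    = 1#
  δ zero    (suc n) = 0#
  δ (suc m) zero    = 0#
  δ (suc m) (suc n) = δ m n

  δ-sym : ∀ m n → δ m n ≈ δ n m
  δ-sym zero    zero    = refl
  δ-sym zero    (suc n) = refl
  δ-sym (suc m) zero    = refl
  δ-sym (suc m) (suc n) = δ-sym m n

  δ-above : ∀ {m n} → m < n → δ m n ≈ 0#
  δ-above {zero}  {suc n} _         = refl
  δ-above {suc m} {suc n} (s≤s m<n) = δ-above m<n

  Σ<-δ : ∀ {m n} (F : Series) → m < n → Σ< n (λ k → F k * δ m k) ≈ F m
  Σ<-δ {zero} {suc n} F _ =
    trans (+-cong (*-identityʳ _) (Σ<-zero n λ k _ → zeroʳ (F (suc k)))) (+-identityʳ _)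
  Σ<-δ {suc m} {suc n} F (s≤s m<n) =
    trans (+-cong (zeroʳ _) (Σ<-δ (F ∘ suc) m<n)) (+-identityˡ _)

  -- Products of series

  infixl 6 _+ˢ_
  _+ˢ_ : Series → Series → Series
  (f +ˢ g) n = f n + g n

  infixr 7 _·ˢ_
  _·ˢ_ : Carrier → Series → Series
  (a ·ˢ f) n = a * f n

  *ˢ-cong : ∀ {f f′ g g′} → f ≈ˢ f′ → g ≈ˢ g′ → f *ˢ g ≈ˢ f′ *ˢ g′
  *ˢ-cong f≈f′ g≈g′ n = Σ<-cong (suc n) λ k _ → *-cong (f≈f′ k) (g≈g′ (n ∸ k))

  *ˢ-congˡ-≤ : ∀ f {g g′} n → (∀ k → k ≤ n → g k ≈ g′ k) → (f *ˢ g) n ≈ (f *ˢ g′) n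
  *ˢ-congˡ-≤ f n g≈g′ = Σ<-cong (suc n) λ k _ → *-congˡ {f k} (g≈g′ (n ∸ k) (m∸n≤m n k))

  -- The only term involving gₙ is f₀ gₙ, which is zero. The strict inequality gained here is what
  -- drives the inductions on degree below.
  *ˢ-congˡ-< : ∀ f {g g′} n → f 0 ≈ 0# → (∀ k → k < n → g k ≈ g′ k) →
               (f *ˢ g) n ≈ (f *ˢ g′) n
  *ˢ-congˡ-< f {g} {g′} zero f₀≈0 g≈g′ =
    +-congʳ (trans (annihilate (g 0)) (sym (annihilate (g′ 0))))
    where
    annihilate : ∀ a → f 0 * a ≈ 0#
    annihilate a = trans (*-congʳ f₀≈0) (zeroˡ a)
  *ˢ-congˡ-< f {g} {g′} (suc n) f₀≈0 g≈g′ =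
    +-cong (trans (annihilate (g (suc n))) (sym (annihilate (g′ (suc n)))))
           (*ˢ-congˡ-≤ (f ∘ suc) n λ k k≤n → g≈g′ k (s≤s k≤n))
    where
    annihilate : ∀ a → f 0 * a ≈ 0#
    annihilate a = trans (*-congʳ f₀≈0) (zeroˡ a)

  *ˢ-zeroʳ : ∀ f n → (f *ˢ λ _ → 0#) n ≈ 0#
  *ˢ-zeroʳ f n = Σ<-zero (suc n) λ k _ → zeroʳ (f k)

  *ˢ-distribʳ : ∀ f g h → (f +ˢ g) *ˢ h ≈ˢ f *ˢ h +ˢ g *ˢ h
  *ˢ-distribʳ f g h n =
    trans (Σ<-cong (suc n) λ k _ → distribʳ (h (n ∸ k)) (f k) (g k))
          (Σ<-+ (suc n) (λ k → f k * h (n ∸ k)) (λ k → g k * h (n ∸ k)))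

  *ˢ-distribˡ : ∀ f g h → f *ˢ (g +ˢ h) ≈ˢ f *ˢ g +ˢ f *ˢ h
  *ˢ-distribˡ f g h n =
    trans (Σ<-cong (suc n) λ k _ → distribˡ (f k) (g (n ∸ k)) (h (n ∸ k)))
          (Σ<-+ (suc n) (λ k → f k * g (n ∸ k)) (λ k → f k * h (n ∸ k)))

  ·ˢ-*ˢ : ∀ a f g → (a ·ˢ f) *ˢ g ≈ˢ a ·ˢ (f *ˢ g)
  ·ˢ-*ˢ a f g n =
    trans (Σ<-cong (suc n) λ k _ → *-assoc a (f k) (g (n ∸ k)))
          (sym (*-Σ< (suc n) a (λ k → f k * g (n ∸ k))))

  *ˢ-·ˢ : ∀ a f g → f *ˢ (a ·ˢ g) ≈ˢ a ·ˢ (f *ˢ g)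
  *ˢ-·ˢ a f g n =
    trans (Σ<-cong (suc n) λ k _ → x∙yz≈y∙xz (f k) a (g (n ∸ k)))
          (sym (*-Σ< (suc n) a (λ k → f k * g (n ∸ k))))

  constˢ-*ˢ : ∀ a g → constˢ a *ˢ g ≈ˢ a ·ˢ g
  constˢ-*ˢ a g zero    = +-identityʳ _
  constˢ-*ˢ a g (suc n) =
    trans (+-congˡ (Σ<-zero (suc n) λ k _ → zeroˡ (g (n ∸ k)))) (+-identityʳ _)

  *ˢ-identityʳ : ∀ f → f *ˢ constˢ 1# ≈ˢ f
  *ˢ-identityʳ f zero    = trans (+-identityʳ _) (*-identityʳ _)
  *ˢ-identityʳ f (suc n) =
    trans (+-congʳ (zeroʳ _)) (trans (+-identityˡ _) (*ˢ-identityʳ (f ∘ suc) n))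

  -- The recursion (fg)ₙ₊₁ = f₀ gₙ₊₁ + (f′g)ₙ, where f = f₀ + t f′, holds by
  -- computation.
  *ˢ-assoc : ∀ f g h → (f *ˢ g) *ˢ h ≈ˢ f *ˢ (g *ˢ h)
  *ˢ-assoc f g h zero = +-congʳ (begin
    (f 0 * g 0 + 0#) * h 0 ≈⟨ *-congʳ (+-identityʳ _) ⟩
    f 0 * g 0 * h 0        ≈⟨ *-assoc _ _ _ ⟩
    f 0 * (g 0 * h 0)      ≈⟨ *-congˡ (+-identityʳ _) ⟨
    f 0 * (g 0 * h 0 + 0#) ∎)
  *ˢ-assoc f g h (suc n) = begin
    (f 0 * g 0 + 0#) * h (suc n) + ((f 0 ·ˢ g′ +ˢ f′ *ˢ g) *ˢ h) n
      ≈⟨ +-cong (trans (*-congʳ (+-identityʳ _)) (*-assoc _ _ _))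
                (trans (*ˢ-distribʳ (f 0 ·ˢ g′) (f′ *ˢ g) h n)
                       (+-cong (·ˢ-*ˢ (f 0) g′ h n) (*ˢ-assoc f′ g h n))) ⟩
    f 0 * (g 0 * h (suc n)) + (f 0 * (g′ *ˢ h) n + (f′ *ˢ (g *ˢ h)) n)
      ≈⟨ +-assoc _ _ _ ⟨
    f 0 * (g 0 * h (suc n)) + f 0 * (g′ *ˢ h) n + (f′ *ˢ (g *ˢ h)) n
      ≈⟨ +-congʳ (distribˡ _ _ _) ⟨
    f 0 * (g *ˢ h) (suc n) + (f′ *ˢ (g *ˢ h)) n ∎
    where
    f′ = f ∘ suc
    g′ = g ∘ suc

  ^ˢ-cong : ∀ {f g} → f ≈ˢ g → ∀ k → f ^ˢ k ≈ˢ g ^ˢ k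
  ^ˢ-cong f≈g zero    n = refl
  ^ˢ-cong f≈g (suc k) n = *ˢ-cong f≈g (^ˢ-cong f≈g k) n

  ^ˢ-vanish : ∀ h → h 0 ≈ 0# → ∀ {k n} → n < k → (h ^ˢ k) n ≈ 0#
  ^ˢ-vanish h h₀≈0 {suc k} {n} (s≤s n≤k) =
    trans (*ˢ-congˡ-< h n h₀≈0 λ i i<n → ^ˢ-vanish h h₀≈0 (≤-trans i<n n≤k))
          (*ˢ-zeroʳ h n)

  t^ˢ≈δ : ∀ k → t ^ˢ k ≈ˢ δ k
  t^ˢ≈δ zero    zero    = refl
  t^ˢ≈δ zero    (suc n) = refl
  t^ˢ≈δ (suc k) zero    = trans (+-congʳ (zeroˡ _)) (+-identityʳ _)
  t^ˢ≈δ (suc k) (suc n) = begin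
    0# * (t ^ˢ k) (suc n) + ((t ∘ suc) *ˢ (t ^ˢ k)) n
      ≈⟨ +-cong (zeroˡ _) (*ˢ-cong {g = t ^ˢ k} t′≈1 (λ _ → refl) n) ⟩
    0# + (constˢ 1# *ˢ (t ^ˢ k)) n
      ≈⟨ +-identityˡ _ ⟩
    (constˢ 1# *ˢ (t ^ˢ k)) n
      ≈⟨ constˢ-*ˢ 1# (t ^ˢ k) n ⟩
    1# * (t ^ˢ k) n
      ≈⟨ *-identityˡ _ ⟩
    (t ^ˢ k) n
      ≈⟨ t^ˢ≈δ k n ⟩
    δ k n ∎
    where
    t′≈1 : t ∘ suc ≈ˢ constˢ 1#
    t′≈1 zero    = refl
    t′≈1 (suc _) = refl

  -- Composition of series

  ∘ˢ-cong : ∀ {f f′ g g′} → f ≈ˢ f′ → g ≈ˢ g′ → f ∘ˢ g ≈ˢ f′ ∘ˢ g′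
  ∘ˢ-cong f≈f′ g≈g′ n = Σ<-cong (suc n) λ k _ → *-cong (f≈f′ k) (^ˢ-cong g≈g′ k n)

  ∘ˢ-+ˢ : ∀ f g h → (f +ˢ g) ∘ˢ h ≈ˢ f ∘ˢ h +ˢ g ∘ˢ h
  ∘ˢ-+ˢ f g h n =
    trans (Σ<-cong (suc n) λ k _ → distribʳ ((h ^ˢ k) n) (f k) (g k))
          (Σ<-+ (suc n) (λ k → f k * (h ^ˢ k) n) (λ k → g k * (h ^ˢ k) n))

  ∘ˢ-·ˢ : ∀ a f h → (a ·ˢ f) ∘ˢ h ≈ˢ a ·ˢ (f ∘ˢ h)
  ∘ˢ-·ˢ a f h n =
    trans (Σ<-cong (suc n) λ k _ → *-assoc a (f k) ((h ^ˢ k) n))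
          (sym (*-Σ< (suc n) a (λ k → f k * (h ^ˢ k) n)))

  constˢ-∘ˢ : ∀ a h → constˢ a ∘ˢ h ≈ˢ constˢ a
  constˢ-∘ˢ a h n =
    trans (+-cong (a*1 n) (Σ<-zero n λ k _ → zeroˡ ((h ^ˢ suc k) n))) (+-identityʳ _)
    where
    a*1 : ∀ n → a * constˢ 1# n ≈ constˢ a n
    a*1 zero    = *-identityʳ a
    a*1 (suc n) = zeroʳ a

  ∘ˢ-constant : ∀ f g → f 0 ≈ 0# → (f ∘ˢ g) 0 ≈ 0#
  ∘ˢ-constant f g f₀≈0 = trans (+-identityʳ _) (trans (*-identityʳ _) f₀≈0)

  module _ (h : Series) (h₀≈0 : h 0 ≈ 0#) where

    -- Powers hᵏ with k > n do not reach degree n. Any larger cutoff may thus replace n + 1, in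
    -- particular one shared by several degrees.
    ∘ˢ-bound : ∀ f {n N} → n < N → (f ∘ˢ h) n ≈ Σ< N (λ k → f k * (h ^ˢ k) n)
    ∘ˢ-bound f {n} n<N = sym (Σ<-extend (λ k → f k * (h ^ˢ k) n) n<N λ k n<k →
      trans (*-congˡ (^ˢ-vanish h h₀≈0 n<k)) (zeroʳ (f k)))

    -- Substitution of h into f = f₀ + t f′. It turns the recursive description of products into one
    -- for compositions.
    ∘ˢ-horner : ∀ f → f ∘ˢ h ≈ˢ constˢ (f 0) +ˢ h *ˢ ((f ∘ suc) ∘ˢ h)
    ∘ˢ-horner f n = +-cong (f₀*1 n) (sym (begin
      (h *ˢ (f′ ∘ˢ h)) n
        -- As h₀ = 0, only degrees m < n of f′(h) contribute, so one cutoff n serves them all. It is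
        -- also the range left in `(f ∘ˢ h) n` once the term k = 0 is split off.
        ≈⟨ *ˢ-congˡ-< h n h₀≈0 (λ m m<n → ∘ˢ-bound f′ m<n) ⟩
      (h *ˢ λ m → Σ< n (λ k → f′ k * (h ^ˢ k) m)) n
        ≈⟨ Σ<-cong (suc n) (λ i _ → *-comm (h i) (Σ< n (λ k → f′ k * (h ^ˢ k) (n ∸ i)))) ⟩
      Σ< (suc n) (λ i → Σ< n (λ k → f′ k * (h ^ˢ k) (n ∸ i)) * h i)
        ≈⟨ Σ<-interchange (suc n) n f′ (λ k i → (h ^ˢ k) (n ∸ i)) h ⟩
      Σ< n (λ k → f′ k * Σ< (suc n) (λ i → (h ^ˢ k) (n ∸ i) * h i))
        ≈⟨ Σ<-cong n (λ k _ → *-congˡ {f′ k} (Σ<-cong (suc n) λ i _ →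
             *-comm ((h ^ˢ k) (n ∸ i)) (h i))) ⟩
      Σ< n (λ k → f′ k * (h ^ˢ suc k) n) ∎))
      where
      f′ = f ∘ suc
      f₀*1 : ∀ n → f 0 * constˢ 1# n ≈ constˢ (f 0) n
      f₀*1 zero    = *-identityʳ (f 0)
      f₀*1 (suc n) = zeroʳ (f 0)

    ∘ˢ-*ˢ : ∀ f g → (f *ˢ g) ∘ˢ h ≈ˢ (f ∘ˢ h) *ˢ (g ∘ˢ h)
    ∘ˢ-*ˢ f g n = below f (ℕ.n<1+n n)
      where
      -- Since h₀ = 0, the coefficient of tⁿ in Horner's formula only involves
      -- lower coefficients of (fg)′(h), which makes this an induction on n.
      below : ∀ f {n N} → n < N → ((f *ˢ g) ∘ˢ h) n ≈ ((f ∘ˢ h) *ˢ (g ∘ˢ h)) n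
      below f {n} {suc N} (s≤s n≤N) = begin
        ((f *ˢ g) ∘ˢ h) n
          ≈⟨ ∘ˢ-horner (f *ˢ g) n ⟩
        constˢ (f 0 * g 0 + 0#) n + (h *ˢ ((f 0 ·ˢ g′ +ˢ f′ *ˢ g) ∘ˢ h)) n
          ≈⟨ +-cong (constant n) (*ˢ-congˡ-< h n h₀≈0 λ m m<n →
               trans (∘ˢ-+ˢ (f 0 ·ˢ g′) (f′ *ˢ g) h m)
                     (+-cong (∘ˢ-·ˢ (f 0) g′ h m) (below f′ (≤-trans m<n n≤N)))) ⟩
        f 0 * constˢ (g 0) n + (h *ˢ (f 0 ·ˢ (g′ ∘ˢ h) +ˢ (f′ ∘ˢ h) *ˢ (g ∘ˢ h))) n
          ≈⟨ +-congˡ (trans (*ˢ-distribˡ h (f 0 ·ˢ (g′ ∘ˢ h)) ((f′ ∘ˢ h) *ˢ (g ∘ˢ h)) n)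
                            (+-cong (*ˢ-·ˢ (f 0) h (g′ ∘ˢ h) n)
                                    (sym (*ˢ-assoc h (f′ ∘ˢ h) (g ∘ˢ h) n)))) ⟩
        f 0 * constˢ (g 0) n +
          (f 0 * (h *ˢ (g′ ∘ˢ h)) n + ((h *ˢ (f′ ∘ˢ h)) *ˢ (g ∘ˢ h)) n)
          ≈⟨ trans (sym (+-assoc _ _ _)) (+-congʳ (sym (distribˡ _ _ _))) ⟩
        f 0 * (constˢ (g 0) +ˢ h *ˢ (g′ ∘ˢ h)) n + ((h *ˢ (f′ ∘ˢ h)) *ˢ (g ∘ˢ h)) n
          ≈⟨ +-congʳ (*-congˡ (∘ˢ-horner g n)) ⟨
        f 0 * (g ∘ˢ h) n + ((h *ˢ (f′ ∘ˢ h)) *ˢ (g ∘ˢ h)) n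
          ≈⟨ +-congʳ (constˢ-*ˢ (f 0) (g ∘ˢ h) n) ⟨
        (constˢ (f 0) *ˢ (g ∘ˢ h)) n + ((h *ˢ (f′ ∘ˢ h)) *ˢ (g ∘ˢ h)) n
          ≈⟨ *ˢ-distribʳ (constˢ (f 0)) (h *ˢ (f′ ∘ˢ h)) (g ∘ˢ h) n ⟨
        ((constˢ (f 0) +ˢ h *ˢ (f′ ∘ˢ h)) *ˢ (g ∘ˢ h)) n
          ≈⟨ *ˢ-cong {g = g ∘ˢ h} (∘ˢ-horner f) (λ _ → refl) n ⟨
        ((f ∘ˢ h) *ˢ (g ∘ˢ h)) n ∎
        where
        f′ = f ∘ suc
        g′ = g ∘ suc
        constant : ∀ n → constˢ (f 0 * g 0 + 0#) n ≈ f 0 * constˢ (g 0) n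
        constant zero    = +-identityʳ _
        constant (suc n) = sym (zeroʳ _)

    ∘ˢ-^ˢ : ∀ f k → (f ^ˢ k) ∘ˢ h ≈ˢ (f ∘ˢ h) ^ˢ k
    ∘ˢ-^ˢ f zero    n = constˢ-∘ˢ 1# h n
    ∘ˢ-^ˢ f (suc k) n =
      trans (∘ˢ-*ˢ f (f ^ˢ k) n) (*ˢ-cong {f ∘ˢ h} (λ _ → refl) (∘ˢ-^ˢ f k) n)

  t-∘ˢ : ∀ h → h 0 ≈ 0# → t ∘ˢ h ≈ˢ h
  t-∘ˢ h h₀≈0 n = begin
    (t ∘ˢ h) n
      -- The cutoff n + 2 makes the terms k = 0 and k = 1 both visible, even for n = 0.
      ≈⟨ ∘ˢ-bound h h₀≈0 t (s≤s (m≤n+m n 1)) ⟩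
    0# * constˢ 1# n + (1# * (h *ˢ constˢ 1#) n + Σ< n (λ k → 0# * (h ^ˢ suc (suc k)) n))
      ≈⟨ +-cong (zeroˡ _) (+-cong (*-identityˡ _)
           (Σ<-zero n λ k _ → zeroˡ ((h ^ˢ suc (suc k)) n))) ⟩
    0# + ((h *ˢ constˢ 1#) n + 0#)
      ≈⟨ trans (+-identityˡ _) (+-identityʳ _) ⟩
    (h *ˢ constˢ 1#) n
      ≈⟨ *ˢ-identityʳ h n ⟩
    h n ∎

  -- After the exchange of sums, fₘ is multiplied by (gᵐ ∘ h)ₙ, and multiplicativity of composition
  -- makes this ((g ∘ h)ᵐ)ₙ.
  ∘ˢ-assoc : ∀ f g h → g 0 ≈ 0# → h 0 ≈ 0# → (f ∘ˢ g) ∘ˢ h ≈ˢ f ∘ˢ (g ∘ˢ h)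
  ∘ˢ-assoc f g h g₀≈0 h₀≈0 n = begin
    ((f ∘ˢ g) ∘ˢ h) n
      ≈⟨ Σ<-cong (suc n) (λ k k<1+n → *-congʳ {(h ^ˢ k) n} (∘ˢ-bound g g₀≈0 f k<1+n)) ⟩
    Σ< (suc n) (λ k → Σ< (suc n) (λ m → f m * (g ^ˢ m) k) * (h ^ˢ k) n)
      ≈⟨ Σ<-interchange (suc n) (suc n) f (g ^ˢ_) (λ k → (h ^ˢ k) n) ⟩
    Σ< (suc n) (λ m → f m * ((g ^ˢ m) ∘ˢ h) n)
      ≈⟨ Σ<-cong (suc n) (λ m _ → *-congˡ {f m} (∘ˢ-^ˢ h h₀≈0 g m n)) ⟩
    (f ∘ˢ (g ∘ˢ h)) n ∎

  -- The product contributes the triangle i + j < N; the vanishing of a from N on fills it up to a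
  -- square. With aₖ = k! hₖ this is the combinatorial core of the adjunction `⟪⟫-*ˢ`.
  Σ<-*ˢ : ∀ N f g (a : Series) → (∀ k → N ≤ k → a k ≈ 0#) →
    Σ< N (λ k → (f *ˢ g) k * a k) ≈
    Σ< N (λ i → f i * Σ< N (λ j → g j * a (i ℕ.+ j)))
  Σ<-*ˢ zero    f g a a≈0 = refl
  Σ<-*ˢ (suc N) f g a a≈0 = begin
    (f 0 * g 0 + 0#) * a 0 + Σ< N (λ k → (f 0 * g′ k + (f′ *ˢ g) k) * a′ k)
      ≈⟨ +-cong (trans (*-congʳ (+-identityʳ _)) (*-assoc _ _ _))
                (trans (Σ<-cong N λ k _ →
                         trans (distribʳ (a′ k) (f 0 * g′ k) ((f′ *ˢ g) k))
                               (+-congʳ (*-assoc (f 0) (g′ k) (a′ k))))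
                       (Σ<-+ N (λ k → f 0 * (g′ k * a′ k)) (λ k → (f′ *ˢ g) k * a′ k))) ⟩
    f 0 * (g 0 * a 0) + (Σ< N (λ k → f 0 * (g′ k * a′ k)) + Σ< N (λ k → (f′ *ˢ g) k * a′ k))
      ≈⟨ +-assoc _ _ _ ⟨
    f 0 * (g 0 * a 0) + Σ< N (λ k → f 0 * (g′ k * a′ k)) + Σ< N (λ k → (f′ *ˢ g) k * a′ k)
      ≈⟨ +-cong (sym (*-Σ< (suc N) (f 0) (λ k → g k * a k)))
                (Σ<-*ˢ N f′ g a′ λ k N≤k → a≈0 (suc k) (s≤s N≤k)) ⟩
    f 0 * Σ< (suc N) (λ k → g k * a k) + Σ< N (λ i → f′ i * Σ< N (λ j → g j * a′ (i ℕ.+ j)))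
      ≈⟨ +-congˡ (Σ<-cong N λ i _ → *-congˡ {f′ i} (sym
           (Σ<-extend (λ j → g j * a′ (i ℕ.+ j)) (ℕ.n≤1+n N) λ j N≤j →
             trans (*-congˡ (a≈0 _ (s≤s (≤-trans N≤j (m≤n+m j i))))) (zeroʳ (g j))))) ⟩
    f 0 * Σ< (suc N) (λ k → g k * a k) +
      Σ< N (λ i → f′ i * Σ< (suc N) (λ j → g j * a′ (i ℕ.+ j))) ∎
    where
    f′ = f ∘ suc
    g′ = g ∘ suc
    a′ = a ∘ suc

  factorial : ℕ → Carrier
  factorial zero    = 1#
  factorial (suc n) = (suc n ×ᶜ 1#) * factorial n

-- An additive map ε out of the coefficients lets the same computations serve for
-- K[x], with ε the identity, and for K[x][z], with ε a coefficient functional of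
-- K[x].
record IsAdditive {r ℓr c ℓ} (R : RawSemiring r ℓr) (S : CommutativeSemiring c ℓ)
  (ε : RawSemiring.Carrier R → CommutativeSemiring.Carrier S) : Set (r ⊔ ℓ) where
  private module R = RawSemiring R
  open CommutativeSemiring S
  field
    ε-0#    : ε R.0# ≈ 0#
    ε-+     : ∀ a b → ε (a R.+ b) ≈ ε a + ε b
    ε-zeroˡ : ∀ a → ε (R.0# R.* a) ≈ 0#
    ε-zeroʳ : ∀ a → ε (a R.* R.0#) ≈ 0#

-- Coefficients of sums, multiples and derivatives, seen through an additive map.

module AdditiveFunctional {r ℓr c ℓ} (R : RawSemiring r ℓr) (S : CommutativeSemiring c ℓ)
  {ε : RawSemiring.Carrier R → CommutativeSemiring.Carrier S} (isAdditive : IsAdditive R S ε)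
  where

  private module R = RawSemiring R
  open CommutativeSemiring S
  open IsAdditive isAdditive
  open RawSemiringOps rawSemiring using (sum) renaming (_×_ to _×ᶜ_)
  open RawSemiringOps R using () renaming (_×_ to _×ᴿ_)
  open Polynomials R
  open RawSemiringOps polyRawSemiring using () renaming (sum to sumᵖ)
  open SeriesProperties S using (factorial)
  open CommutativeSemigroupProperties *-commutativeSemigroup using (x∙yz≈yx∙z)
  open SetoidReasoning setoid

  ε-+ᵖ : ∀ p q n → ε (coeff (p +ᵖ q) n) ≈ ε (coeff p n) + ε (coeff q n)
  ε-+ᵖ []      q       n       = sym (trans (+-congʳ ε-0#) (+-identityˡ _))
  ε-+ᵖ (a ∷ p) []      n       = sym (trans (+-congˡ ε-0#) (+-identityʳ _))
  ε-+ᵖ (a ∷ p) (b ∷ q) zero    = ε-+ a b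
  ε-+ᵖ (a ∷ p) (b ∷ q) (suc n) = ε-+ᵖ p q n

  ε-sumᵖ : ∀ {N} F n → ε (coeff (sumᵖ {N} F) n) ≈ sum {N} (λ i → ε (coeff (F i) n))
  ε-sumᵖ {zero}  F n = ε-0#
  ε-sumᵖ {suc N} F n =
    trans (ε-+ᵖ (F Fin.zero) (sumᵖ (F ∘ Fin.suc)) n) (+-congˡ (ε-sumᵖ (F ∘ Fin.suc) n))

  ε-· : ∀ a p n → ε (coeff (a · p) n) ≈ ε (a R.* coeff p n)
  ε-· a []      n       = trans ε-0# (sym (ε-zeroʳ a))
  ε-· a (b ∷ p) zero    = refl
  ε-· a (b ∷ p) (suc n) = ε-· a p n

  ε-eval-0# : ∀ p → ε (eval p R.0#) ≈ ε (coeff p 0)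
  ε-eval-0# []      = refl
  ε-eval-0# (a ∷ p) =
    trans (ε-+ a _) (trans (+-congˡ (ε-zeroˡ (eval p R.0#))) (+-identityʳ _))

  ε-× : ∀ n a → ε (n ×ᴿ a) ≈ (n ×ᶜ 1#) * ε a
  ε-× zero    a = trans ε-0# (sym (zeroˡ _))
  ε-× (suc n) a = begin
    ε (a R.+ n ×ᴿ a)              ≈⟨ ε-+ a (n ×ᴿ a) ⟩
    ε a + ε (n ×ᴿ a)              ≈⟨ +-cong (sym (*-identityˡ _)) (ε-× n a) ⟩
    1# * ε a + (n ×ᶜ 1#) * ε a    ≈⟨ distribʳ _ _ _ ⟨
    (1# + n ×ᶜ 1#) * ε a          ∎

  ε-weightFrom : ∀ m p n →
    ε (coeff (weightFrom m p) n) ≈ ((m ℕ.+ n) ×ᶜ 1#) * ε (coeff p n)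
  ε-weightFrom m []      n    = trans ε-0# (sym (trans (*-congˡ ε-0#) (zeroʳ _)))
  ε-weightFrom m (a ∷ p) zero rewrite ℕ.+-identityʳ m = ε-× m a
  ε-weightFrom m (a ∷ p) (suc n) rewrite ℕ.+-suc m n = ε-weightFrom (suc m) p n

  ε-D : ∀ p n → ε (coeff (D p) n) ≈ (suc n ×ᶜ 1#) * ε (coeff p (suc n))
  ε-D []      n = trans ε-0# (sym (trans (*-congˡ ε-0#) (zeroʳ _)))
  ε-D (a ∷ p) n = ε-weightFrom 1 p n

  -- In the weighted coefficients n! pₙ each derivative shifts the index by one; stating it so
  -- avoids the quotient (ν + n)!/n!.
  ε-D^ : ∀ ν p n → factorial n * ε (coeff (D^ ν p) n) ≈
                   factorial (ν ℕ.+ n) * ε (coeff p (ν ℕ.+ n))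
  ε-D^ zero    p n = refl
  ε-D^ (suc ν) p n = begin
    factorial n * ε (coeff (D (D^ ν p)) n)
      ≈⟨ *-congˡ (ε-D (D^ ν p) n) ⟩
    factorial n * ((suc n ×ᶜ 1#) * ε (coeff (D^ ν p) (suc n)))
      ≈⟨ x∙yz≈yx∙z _ _ _ ⟩
    factorial (suc n) * ε (coeff (D^ ν p) (suc n))
      ≈⟨ ε-D^ ν p (suc n) ⟩
    factorial (ν ℕ.+ suc n) * ε (coeff p (ν ℕ.+ suc n))
      ≡⟨ ≡.cong (λ m → factorial m * ε (coeff p m)) (ℕ.+-suc ν n) ⟩
    factorial (suc ν ℕ.+ n) * ε (coeff p (suc ν ℕ.+ n)) ∎

  ε-D^-0 : ∀ ν p → ε (coeff (D^ ν p) 0) ≈ factorial ν * ε (coeff p ν)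
  ε-D^-0 ν p with ε-D^ ν p 0
  ... | eq rewrite ℕ.+-identityʳ ν = trans (sym (*-identityˡ _)) eq

-- Poweroids, the pairing with polynomials, and the symbolic exponentials.

module PoweroidProperties {c ℓ} (K : CommutativeRing c ℓ)
                          (inv : PositiveIntegersInvertible K) where

  open CommutativeRing K
  open Semiring semiring using (rawSemiring)
  open PositiveIntegersInvertible inv
  open Poweroids K inv
  open SeriesProperties commutativeSemiring
  open RawSemiringOps rawSemiring using () renaming (_×_ to _×ᶜ_)
  open RawSemiringOps seriesRawSemiring using () renaming (_^_ to _^ˢ_)
  open RawSemiringOps K[x].seriesRawSemiring using () renaming (_^_ to _^ˣ_)
  open CommutativeSemigroupProperties *-commutativeSemigroup 
    using (x∙yz≈y∙xz; x∙yz≈xz∙y; x∙yz≈yx∙z; xy∙z≈y∙xz; interchange)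
  open CommutativeMonoidSum +-commutativeMonoid using (sum-cong-≋)
  open SetoidReasoning setoid

  id-isAdditive : IsAdditive rawSemiring commutativeSemiring (λ a → a)
  id-isAdditive = record
    { ε-0# = refl ; ε-+ = λ _ _ → refl ; ε-zeroˡ = zeroˡ ; ε-zeroʳ = zeroʳ }

  module Coefficients = AdditiveFunctional rawSemiring commutativeSemiring id-isAdditive
  open Coefficients using () renaming (ε-+ᵖ to coeff-+ᵖ; ε-· to coeff-·; ε-sumᵖ to coeff-sumᵖ)

  -- Coefficients of polynomials

  coeff-beyond : ∀ p {n} → length p ≤ n → coeff p n ≈ 0#
  coeff-beyond []      _         = refl
  coeff-beyond (a ∷ p) (s≤s p≤n) = coeff-beyond p p≤n

  coeff-lookup : ∀ p i → lookup p i ≡ coeff p (toℕ i)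
  coeff-lookup (a ∷ p) Fin.zero    = ≡.refl
  coeff-lookup (a ∷ p) (Fin.suc i) = coeff-lookup p i

  coeff-replacePowers : ∀ p q n →
    coeff (replacePowers p q) n ≈ Σ< (length p) (λ k → coeff p k * coeff (q k) n)
  coeff-replacePowers p q n =
    trans (coeff-sumᵖ {length p} (λ i → lookup p i · q (toℕ i)) n)
          (sum-cong-≋ λ i → trans (coeff-· (lookup p i) (q (toℕ i)) n)
                                  (*-congʳ (reflexive (coeff-lookup p i))))

  -- The right factor need only have the coefficients of a constant: the computed powers and values
  -- at z = 0 to which this applies are lists that may carry trailing zeros.
  coeff-*ᵖ-const : ∀ p q {b} → coeff q ≈ˢ constˢ b → ∀ n → coeff (p *ᵖ q) n ≈ coeff p n * b
  coeff-*ᵖ-const []      q {b} q≈b n = sym (zeroˡ b)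
  coeff-*ᵖ-const (a ∷ p) q {b} q≈b n =
    trans (coeff-+ᵖ (a · q) (0# ∷ p *ᵖ q) n)
          (trans (+-congʳ (trans (coeff-· a q n) (*-congˡ (q≈b n)))) (step n))
    where
    step : ∀ n → a * constˢ b n + coeff (0# ∷ p *ᵖ q) n ≈ coeff (a ∷ p) n * b
    step zero    = +-identityʳ _
    step (suc n) =
      trans (+-cong (zeroʳ a) (coeff-*ᵖ-const p q q≈b n)) (+-identityˡ _)

  coeff-const-*ᵖ : ∀ a q n → coeff (constᵖ a *ᵖ q) n ≈ a * coeff q n
  coeff-const-*ᵖ a q n =
    trans (coeff-+ᵖ (a · q) (0# ∷ []) n)
          (trans (+-cong (coeff-· a q n) (0∷[]≈0 n)) (+-identityʳ _))
    where
    0∷[]≈0 : ∀ n → coeff (0# ∷ []) n ≈ 0#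
    0∷[]≈0 zero    = refl
    0∷[]≈0 (suc n) = refl

  -- Multiplication by a′x. The entries are given up to equality because x times the constant ψₘ
  -- computes to the list with entries 0 ψₘ + 0 and 1 ψₘ + 0.
  coeff-linear-*ᵖ : ∀ {b a a′} q → b ≈ 0# → a ≈ a′ → ∀ n →
    coeff ((b ∷ a ∷ []) *ᵖ q) n ≈ a′ * coeff (0# ∷ q) n
  coeff-linear-*ᵖ {b} {a} {a′} q b≈0 a≈a′ n =
    trans (coeff-+ᵖ (b · q) (0# ∷ constᵖ a *ᵖ q) n)
          (trans (+-cong (trans (coeff-· b q n) (trans (*-congʳ b≈0) (zeroˡ _))) (step n))
                 (+-identityˡ _))
    where
    step : ∀ n → coeff (0# ∷ constᵖ a *ᵖ q) n ≈ a′ * coeff (0# ∷ q) n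
    step zero    = sym (zeroʳ a′)
    step (suc n) = trans (coeff-const-*ᵖ a q n) (*-congʳ a≈a′)

  coeff-z^ : ∀ n → coeff (z^ n) ≈ˢ δ n
  coeff-z^ zero    zero    = refl
  coeff-z^ zero    (suc j) = refl
  coeff-z^ (suc n) j       =
    trans (coeff-linear-*ᵖ (z^ n) refl refl j) (trans (*-identityˡ _) (step j))
    where
    step : ∀ j → coeff (0# ∷ z^ n) j ≈ δ (suc n) j
    step zero    = refl
    step (suc j) = coeff-z^ n j

  -- Operators over K[x]

  coeff-[] : coeff [] ≈ˢ constˢ 0#
  coeff-[] zero    = refl
  coeff-[] (suc n) = refl

  coeff-isAdditive : ∀ j → IsAdditive polyRawSemiring commutativeSemiring (λ p → coeff p j)
  coeff-isAdditive j = record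
    { ε-0#    = refl
    ; ε-+     = λ p q → coeff-+ᵖ p q j
    ; ε-zeroˡ = λ _ → refl
    ; ε-zeroʳ = λ p → trans (coeff-*ᵖ-const p [] coeff-[] j) (zeroʳ _)
    }

  module BivariateCoefficients (j : ℕ) =
    AdditiveFunctional polyRawSemiring commutativeSemiring (coeff-isAdditive j)

  -- This is (xψ)ᵏ = xᵏ ψᵏ, with `δ k j` as the coefficient of xʲ in xᵏ.
  coeff-xψ^ : ∀ ψ k n j →
    coeff (((λ m → var *ᵖ constᵖ (ψ m)) ^ˣ k) n) j ≈ δ k j * (ψ ^ˢ k) n
  coeff-xψ^ ψ zero    zero    zero    = sym (*-identityˡ 1#)
  coeff-xψ^ ψ zero    zero    (suc j) = sym (zeroˡ _)
  coeff-xψ^ ψ zero    (suc n) zero    = sym (zeroʳ _)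
  coeff-xψ^ ψ zero    (suc n) (suc j) = sym (zeroʳ _)
  coeff-xψ^ ψ (suc k) n       j       = begin
    coeff ((xψ ^ˣ suc k) n) j
      ≈⟨ coeff-sumᵖ {suc n} (λ i → xψ (toℕ i) *ᵖ (xψ ^ˣ k) (n ∸ toℕ i)) j ⟩
    Σ< (suc n) (λ i → coeff (xψ i *ᵖ (xψ ^ˣ k) (n ∸ i)) j)
      ≈⟨ Σ<-cong (suc n) (λ i _ →
           coeff-linear-*ᵖ ((xψ ^ˣ k) (n ∸ i))
             (trans (+-identityʳ _) (zeroˡ (ψ i))) (trans (+-identityʳ _) (*-identityˡ (ψ i))) j) ⟩
    Σ< (suc n) (λ i → ψ i * coeff (0# ∷ (xψ ^ˣ k) (n ∸ i)) j)
      ≈⟨ Σ<-cong (suc n) (λ i _ → *-congˡ {ψ i} (step j (n ∸ i))) ⟩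
    (ψ *ˢ (δ (suc k) j ·ˢ ψ ^ˢ k)) n
      ≈⟨ *ˢ-·ˢ (δ (suc k) j) ψ (ψ ^ˢ k) n ⟩
    δ (suc k) j * (ψ ^ˢ suc k) n ∎
    where
    xψ : K[x].Series
    xψ m = var *ᵖ constᵖ (ψ m)
    step : ∀ j m → coeff (0# ∷ (xψ ^ˣ k) m) j ≈ δ (suc k) j * (ψ ^ˢ k) m
    step zero    m = sym (zeroˡ _)
    step (suc j) m = coeff-xψ^ ψ k m j

  coeff-liftˢ^ : ∀ ψ k n → coeff ((liftˢ ψ ^ˣ k) n) ≈ˢ constˢ ((ψ ^ˢ k) n)
  coeff-liftˢ^ ψ zero    zero    zero    = refl
  coeff-liftˢ^ ψ zero    zero    (suc j) = refl
  coeff-liftˢ^ ψ zero    (suc n) zero    = refl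
  coeff-liftˢ^ ψ zero    (suc n) (suc j) = refl
  coeff-liftˢ^ ψ (suc k) n       j       =
    trans (coeff-sumᵖ {suc n} (λ i → liftˢ ψ (toℕ i) *ᵖ (liftˢ ψ ^ˣ k) (n ∸ toℕ i)) j)
          (trans (Σ<-cong (suc n) λ i _ →
                   trans (coeff-const-*ᵖ (ψ i) ((liftˢ ψ ^ˣ k) (n ∸ i)) j)
                         (*-congˡ (coeff-liftˢ^ ψ k (n ∸ i) j)))
                 (step j))
    where
    step : ∀ j → Σ< (suc n) (λ i → ψ i * constˢ ((ψ ^ˢ k) (n ∸ i)) j) ≈
                 constˢ ((ψ ^ˢ suc k) n) j
    step zero    = refl
    step (suc j) = Σ<-zero (suc n) λ i _ → zeroʳ (ψ i)

  coeff-e^x : ∀ ψ → ψ 0 ≈ 0# → ∀ n j → coeff ((e^x ψ) n) j ≈ 1/ j ! * (ψ ^ˢ j) n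
  coeff-e^x ψ ψ₀≈0 n j = begin
    coeff ((e^x ψ) n) j
      ≈⟨ coeff-sumᵖ {suc n} (λ k → constᵖ (1/ toℕ k !) *ᵖ (xψ ^ˣ toℕ k) n) j ⟩
    Σ< (suc n) (λ k → coeff (constᵖ (1/ k !) *ᵖ (xψ ^ˣ k) n) j)
      ≈⟨ Σ<-cong (suc n) (λ k _ → trans (coeff-const-*ᵖ (1/ k !) ((xψ ^ˣ k) n) j)
           (trans (*-congˡ (trans (coeff-xψ^ ψ k n j) (*-congʳ (δ-sym k j))))
                  (x∙yz≈xz∙y (1/ k !) (δ j k) ((ψ ^ˢ k) n)))) ⟩
    Σ< (suc n) (λ k → 1/ k ! * (ψ ^ˢ k) n * δ j k)
      -- For j > n the range k ≤ n misses the index k = j that `δ j` selects. Passing to k ≤ j is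
      -- harmless, since ψᵏ has no coefficient in degree n < k.
      ≈⟨ Σ<-agree (suc n) (suc j) (λ k → 1/ k ! * (ψ ^ˢ k) n * δ j k)
           (λ k n<k → trans (*-congʳ (trans (*-congˡ (^ˢ-vanish ψ ψ₀≈0 n<k)) (zeroʳ _)))
                            (zeroˡ _))
           (λ k j<k → trans (*-congˡ (δ-above j<k)) (zeroʳ _)) ⟩
    Σ< (suc j) (λ k → 1/ k ! * (ψ ^ˢ k) n * δ j k)
      ≈⟨ Σ<-δ (λ k → 1/ k ! * (ψ ^ˢ k) n) (ℕ.n<1+n j) ⟩
    1/ j ! * (ψ ^ˢ j) n ∎
    where
    xψ : K[x].Series
    xψ m = var *ᵖ constᵖ (ψ m)

  -- The value (f(D) h)(0) for f ∈ K[[t]].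
  ⟪_,_⟫ : Series → Poly → Carrier
  ⟪ f , h ⟫ = Σ< (length h) λ k → f k * (factorial k * coeff h k)

  ⟪⟫-beyond : ∀ (f : Series) h k → length h ≤ k → f k * (factorial k * coeff h k) ≈ 0#
  ⟪⟫-beyond f h k h≤k =
    trans (*-congˡ (trans (*-congˡ (coeff-beyond h h≤k)) (zeroʳ _))) (zeroʳ _)

  ⟪⟫-congˡ : ∀ {f g} h → f ≈ˢ g → ⟪ f , h ⟫ ≈ ⟪ g , h ⟫
  ⟪⟫-congˡ h f≈g = Σ<-cong (length h) λ k _ → *-congʳ {factorial k * coeff h k} (f≈g k)

  ⟪⟫-congʳ : ∀ f p q → p ≈ᵖ q → ⟪ f , p ⟫ ≈ ⟪ f , q ⟫
  ⟪⟫-congʳ f p q p≈q =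
    trans (Σ<-cong (length p) λ k _ → *-congˡ {f k} (*-congˡ {factorial k} (p≈q k)))
          (Σ<-agree (length p) (length q) (λ k → f k * (factorial k * coeff q k))
            (λ k p≤k → trans (*-congˡ (*-congˡ (sym (p≈q k)))) (⟪⟫-beyond f p k p≤k))
            (⟪⟫-beyond f q))

  ⟪⟫-· : ∀ f a h → ⟪ f , a · h ⟫ ≈ a * ⟪ f , h ⟫
  ⟪⟫-· f a h = begin
    ⟪ f , a · h ⟫
      ≡⟨ ≡.cong (λ N → Σ< N (λ k → f k * (factorial k * coeff (a · h) k)))
                (length-map (a *_) h) ⟩
    Σ< (length h) (λ k → f k * (factorial k * coeff (a · h) k))
      ≈⟨ Σ<-cong (length h) (λ k _ → trans
           (*-congˡ {f k} (trans (*-congˡ (coeff-· a h k)) (x∙yz≈y∙xz (factorial k) a (coeff h k))))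
           (x∙yz≈y∙xz (f k) a (factorial k * coeff h k))) ⟩
    Σ< (length h) (λ k → a * (f k * (factorial k * coeff h k)))
      ≈⟨ *-Σ< (length h) a (λ k → f k * (factorial k * coeff h k)) ⟨
    a * ⟪ f , h ⟫ ∎

  ⟪δ⟫ : ∀ j h → ⟪ δ j , h ⟫ ≈ factorial j * coeff h j
  ⟪δ⟫ j h =
    trans (Σ<-cong (length h) λ k _ → *-comm (δ j k) (factorial k * coeff h k))
    (trans (Σ<-agree (length h) (suc j) (λ k → factorial k * coeff h k * δ j k)
             (λ k h≤k → trans (*-comm _ (δ j k)) (⟪⟫-beyond (δ j) h k h≤k))
             (λ k j<k → trans (*-congˡ (δ-above j<k)) (zeroʳ _)))
           (Σ<-δ (λ k → factorial k * coeff h k) (ℕ.n<1+n j)))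

  coeff-⟨D⟩ : ∀ f h j → factorial j * coeff (f ⟨D⟩ h) j ≈
    Σ< (length h) (λ ν → f ν * (factorial (ν ℕ.+ j) * coeff h (ν ℕ.+ j)))
  coeff-⟨D⟩ f h j = begin
    factorial j * coeff (f ⟨D⟩ h) j
      ≈⟨ *-congˡ (coeff-sumᵖ {length h} (λ ν → f (toℕ ν) · D^ (toℕ ν) h) j) ⟩
    factorial j * Σ< (length h) (λ ν → coeff (f ν · D^ ν h) j)
      ≈⟨ *-Σ< (length h) (factorial j) (λ ν → coeff (f ν · D^ ν h) j) ⟩
    Σ< (length h) (λ ν → factorial j * coeff (f ν · D^ ν h) j)
      ≈⟨ Σ<-cong (length h) (λ ν _ → trans (*-congˡ (coeff-· (f ν) (D^ ν h) j))
           (trans (x∙yz≈y∙xz (factorial j) (f ν) _) (*-congˡ (Coefficients.ε-D^ ν h j)))) ⟩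
    Σ< (length h) (λ ν → f ν * (factorial (ν ℕ.+ j) * coeff h (ν ℕ.+ j))) ∎

  -- The operator of fg applies f(D) first and g(D) afterwards. On the sequence aₖ = k! hₖ, f(D)
  -- yields Σᵢ fᵢ aᵢ₊ⱼ, the transpose of the Cauchy product with f.
  ⟪⟫-*ˢ : ∀ f g h → ⟪ f *ˢ g , h ⟫ ≈ ⟪ g , f ⟨D⟩ h ⟫
  ⟪⟫-*ˢ f g h = begin
    ⟪ f *ˢ g , h ⟫
      ≈⟨ Σ<-*ˢ N f g a a≈0 ⟩
    Σ< N (λ i → f i * Σ< N (λ j → g j * a (i ℕ.+ j)))
      ≈⟨ Σ<-cong N (λ i _ → *-congˡ {f i} (Σ<-cong N λ j _ → *-comm (g j) (a (i ℕ.+ j)))) ⟩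
    Σ< N (λ i → f i * Σ< N (λ j → a (i ℕ.+ j) * g j))
      ≈⟨ Σ<-interchange N N f (λ i j → a (i ℕ.+ j)) g ⟨
    Σ< N (λ j → Σ< N (λ i → f i * a (i ℕ.+ j)) * g j)
      ≈⟨ Σ<-cong N (λ j _ → trans (*-comm _ (g j)) (*-congˡ (sym (coeff-⟨D⟩ f h j)))) ⟩
    Σ< N (λ j → g j * (factorial j * coeff (f ⟨D⟩ h) j))
      ≈⟨ Σ<-agree N (length (f ⟨D⟩ h)) (λ j → g j * (factorial j * coeff (f ⟨D⟩ h) j))
           (λ j N≤j → trans (*-congˡ (trans (coeff-⟨D⟩ f h j)
              (Σ<-zero N λ i _ → trans (*-congˡ (a≈0 (i ℕ.+ j) (≤-trans N≤j (m≤n+m j i))))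
                                       (zeroʳ (f i)))))
              (zeroʳ (g j)))
           (⟪⟫-beyond g (f ⟨D⟩ h)) ⟩
    ⟪ g , f ⟨D⟩ h ⟫ ∎
    where
    N = length h
    a : Series
    a k = factorial k * coeff h k
    a≈0 : ∀ k → N ≤ k → a k ≈ 0#
    a≈0 k N≤k = trans (*-congˡ (coeff-beyond h N≤k)) (zeroʳ _)

  -- The passage from K[x][z] back to K: h has constant coefficients in K[x], so extracting xʲ
  -- affects only the operator f.
  coeff-at-0 : ∀ f h j → coeff (f at-0 h) j ≈ ⟪ (λ ν → coeff (f ν) j) , h ⟫
  coeff-at-0 f h j = begin
    coeff (f at-0 h) j
      ≈⟨ Bivariate.ε-eval-0# (f K[x].⟨D⟩ liftᵖ h) ⟩
    coeff (K[x].coeff (f K[x].⟨D⟩ liftᵖ h) 0) j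
      ≈⟨ Bivariate.ε-sumᵖ {length (liftᵖ h)}
           (λ ν → f (toℕ ν) K[x].· K[x].D^ (toℕ ν) (liftᵖ h)) 0 ⟩
    Σ< (length (liftᵖ h)) (λ ν → coeff (K[x].coeff (f ν K[x].· K[x].D^ ν (liftᵖ h)) 0) j)
      ≡⟨ ≡.cong (λ N → Σ< N (λ ν → coeff (K[x].coeff (f ν K[x].· K[x].D^ ν (liftᵖ h)) 0) j))
                (length-map constᵖ h) ⟩
    Σ< (length h) (λ ν → coeff (K[x].coeff (f ν K[x].· K[x].D^ ν (liftᵖ h)) 0) j)
      ≈⟨ Σ<-cong (length h) (λ ν _ →
           trans (Bivariate.ε-· (f ν) (K[x].D^ ν (liftᵖ h)) 0)
                 (coeff-*ᵖ-const (f ν) _ (D^-liftᵖ ν) j)) ⟩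
    ⟪ (λ ν → coeff (f ν) j) , h ⟫ ∎
    where
    module Bivariate = BivariateCoefficients j
    coeff-liftᵖ : ∀ p ν → coeff (K[x].coeff (liftᵖ p) ν) ≈ˢ constˢ (coeff p ν)
    coeff-liftᵖ []      ν       i       = coeff-[] i
    coeff-liftᵖ (a ∷ p) zero    zero    = refl
    coeff-liftᵖ (a ∷ p) zero    (suc i) = refl
    coeff-liftᵖ (a ∷ p) (suc ν) i       = coeff-liftᵖ p ν i
    *-constˢ : ∀ a b i → a * constˢ b i ≈ constˢ (a * b) i
    *-constˢ a b zero    = refl
    *-constˢ a b (suc i) = zeroʳ a
    D^-liftᵖ : ∀ ν → coeff (K[x].coeff (K[x].D^ ν (liftᵖ h)) 0) ≈ˢ
                     constˢ (factorial ν * coeff h ν)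
    D^-liftᵖ ν i =
      trans (BivariateCoefficients.ε-D^-0 i ν (liftᵖ h))
            (trans (*-congˡ (coeff-liftᵖ h ν i)) (*-constˢ (factorial ν) (coeff h ν) i))

  coeff-at-0-z^ : ∀ f n j → coeff (f at-0 (z^ n)) j ≈ factorial n * coeff (f n) j
  coeff-at-0-z^ f n j = begin
    coeff (f at-0 (z^ n)) j
      ≈⟨ coeff-at-0 f (z^ n) j ⟩
    ⟪ F , z^ n ⟫
      ≈⟨ Σ<-agree (length (z^ n)) (suc n) (λ k → F k * (factorial k * coeff (z^ n) k))
           (⟪⟫-beyond F (z^ n))
           (λ k n<k → trans (*-congˡ (trans (*-congˡ (trans (coeff-z^ n k) (δ-above n<k)))
                                            (zeroʳ _)))
                            (zeroʳ _)) ⟩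
    Σ< (suc n) (λ k → F k * (factorial k * coeff (z^ n) k))
      ≈⟨ Σ<-cong (suc n) (λ k _ → trans (sym (*-assoc (F k) (factorial k) _))
           (*-cong (*-comm (F k) (factorial k)) (coeff-z^ n k))) ⟩
    Σ< (suc n) (λ k → factorial k * F k * δ n k)
      ≈⟨ Σ<-δ (λ k → factorial k * F k) (ℕ.n<1+n n) ⟩
    factorial n * F n ∎
    where
    F : Series
    F k = coeff (f k) j

  factorial*1/! : ∀ n → factorial n * 1/ n ! ≈ 1#
  factorial*1/! zero    = *-identityˡ 1#
  factorial*1/! (suc n) =
    trans (interchange _ _ _ _)
          (trans (*-cong (1/suc-inverse n) (factorial*1/! n)) (*-identityˡ 1#))

  -- Applying e^{xη₁} to 0₁^ν gives ν! times its coefficient at D^ν, and the factor 1/ν! cancels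
  -- this. So e^{xη₁} e^{0₁·η₂} is just e^{xψ₁} with ψ₂ substituted for t.
  coeff-e^x-e^0 : ∀ ψ₁ ψ₂ n j →
    coeff ((e^x ψ₁ e^0· ψ₂) n) j ≈ ((λ ν → coeff ((e^x ψ₁) ν) j) ∘ˢ ψ₂) n
  coeff-e^x-e^0 ψ₁ ψ₂ n j =
    trans (coeff-sumᵖ {suc n} (λ ν → A (toℕ ν) *ᵖ (liftˢ ψ₂ ^ˣ toℕ ν) n) j)
          (Σ<-cong (suc n) λ ν _ →
            trans (coeff-*ᵖ-const (A ν) ((liftˢ ψ₂ ^ˣ ν) n) (coeff-liftˢ^ ψ₂ ν n) j)
                  (*-congʳ (coeff-A ν)))
    where
    A : K[x].Series
    A ν = 1/ ν ! · ((e^x ψ₁) at-0 (z^ ν))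
    coeff-A : ∀ ν → coeff (A ν) j ≈ coeff ((e^x ψ₁) ν) j
    coeff-A ν = begin
      coeff (A ν) j
        ≈⟨ coeff-· (1/ ν !) ((e^x ψ₁) at-0 (z^ ν)) j ⟩
      1/ ν ! * coeff ((e^x ψ₁) at-0 (z^ ν)) j
        ≈⟨ *-congˡ (coeff-at-0-z^ (e^x ψ₁) ν j) ⟩
      1/ ν ! * (factorial ν * coeff ((e^x ψ₁) ν) j)
        ≈⟨ x∙yz≈yx∙z (1/ ν !) (factorial ν) _ ⟩
      factorial ν * 1/ ν ! * coeff ((e^x ψ₁) ν) j
        ≈⟨ *-congʳ (factorial*1/! ν) ⟩
      1# * coeff ((e^x ψ₁) ν) j
        ≈⟨ *-identityˡ _ ⟩
      coeff ((e^x ψ₁) ν) j ∎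

  e^x-∘ˢ : ∀ ψ₁ ψ₂ → ψ₁ 0 ≈ 0# → ψ₂ 0 ≈ 0# →
    (e^x (ψ₁ ∘ˢ ψ₂)) K[x].≈ˢ (e^x ψ₁ e^0· ψ₂)
  e^x-∘ˢ ψ₁ ψ₂ ψ₁₀≈0 ψ₂₀≈0 n j = begin
    coeff ((e^x (ψ₁ ∘ˢ ψ₂)) n) j
      ≈⟨ coeff-e^x (ψ₁ ∘ˢ ψ₂) (∘ˢ-constant ψ₁ ψ₂ ψ₁₀≈0) n j ⟩
    1/ j ! * ((ψ₁ ∘ˢ ψ₂) ^ˢ j) n
      ≈⟨ *-congˡ (∘ˢ-^ˢ ψ₂ ψ₂₀≈0 ψ₁ j n) ⟨
    1/ j ! * ((ψ₁ ^ˢ j) ∘ˢ ψ₂) n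
      ≈⟨ ∘ˢ-·ˢ (1/ j !) (ψ₁ ^ˢ j) ψ₂ n ⟨
    ((1/ j ! ·ˢ ψ₁ ^ˢ j) ∘ˢ ψ₂) n
      ≈⟨ ∘ˢ-cong {g = ψ₂} (λ ν → coeff-e^x ψ₁ ψ₁₀≈0 ν j) (λ _ → refl) n ⟨
    ((λ ν → coeff ((e^x ψ₁) ν) j) ∘ˢ ψ₂) n
      ≈⟨ coeff-e^x-e^0 ψ₁ ψ₂ n j ⟨
    coeff ((e^x ψ₁ e^0· ψ₂) n) j ∎

  -- Poweroids

  module _ (φ : DeltaSeries) (p : ℕ → Poly) (isPoweroids : IsPoweroids φ p) where

    open IsPoweroids isPoweroids

    ⟪φ^,p⟫ : ∀ m n → ⟪ series φ ^ˢ m , p n ⟫ ≈ factorial n * δ n m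
    ⟪φ^,p⟫ zero n = begin
      ⟪ constˢ 1# , p n ⟫ ≈⟨ ⟪⟫-congˡ (p n) constˢ1≈δ ⟩
      ⟪ δ 0 , p n ⟫       ≈⟨ ⟪δ⟫ 0 (p n) ⟩
      1# * coeff (p n) 0  ≈⟨ *-identityˡ _ ⟩
      coeff (p n) 0       ≈⟨ at-zero′ n ⟩
      factorial n * δ n 0 ∎
      where
      constˢ1≈δ : constˢ 1# ≈ˢ δ 0
      constˢ1≈δ zero    = refl
      constˢ1≈δ (suc _) = refl
      at-zero′ : ∀ n → coeff (p n) 0 ≈ factorial n * δ n 0
      at-zero′ zero    = trans (p-zero 0) (sym (*-identityˡ 1#))
      at-zero′ (suc n) =
        trans (sym (Coefficients.ε-eval-0# (p (suc n)))) (trans (at-zero n) (sym (zeroʳ _)))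
    ⟪φ^,p⟫ (suc m) zero = begin
      ⟪ series φ ^ˢ suc m , p 0 ⟫
        -- Since p 0 is the constant 1, only the constant term of φᵐ⁺¹ is seen, and it vanishes.
        ≈⟨ ⟪⟫-congʳ (series φ ^ˢ suc m) (p 0) (constᵖ 1#) p-zero ⟩
      (series φ ^ˢ suc m) 0 * (1# * 1#) + 0#
        ≈⟨ +-identityʳ _ ⟩
      (series φ ^ˢ suc m) 0 * (1# * 1#)
        ≈⟨ *-congʳ (^ˢ-vanish (series φ) (constant φ) {suc m} z<s) ⟩
      0# * (1# * 1#)
        ≈⟨ trans (zeroˡ _) (sym (zeroʳ _)) ⟩
      1# * 0# ∎
    ⟪φ^,p⟫ (suc m) (suc n) = begin
      ⟪ series φ ^ˢ suc m , p (suc n) ⟫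
        ≈⟨ ⟪⟫-*ˢ (series φ) (series φ ^ˢ m) (p (suc n)) ⟩
      ⟪ series φ ^ˢ m , series φ ⟨D⟩ p (suc n) ⟫
        ≈⟨ ⟪⟫-congʳ (series φ ^ˢ m) (series φ ⟨D⟩ p (suc n)) ((suc n ×ᶜ 1#) · p n) (lowers n) ⟩
      ⟪ series φ ^ˢ m , (suc n ×ᶜ 1#) · p n ⟫
        ≈⟨ ⟪⟫-· (series φ ^ˢ m) (suc n ×ᶜ 1#) (p n) ⟩
      (suc n ×ᶜ 1#) * ⟪ series φ ^ˢ m , p n ⟫
        ≈⟨ *-congˡ (⟪φ^,p⟫ m n) ⟩
      (suc n ×ᶜ 1#) * (factorial n * δ n m)
        ≈⟨ *-assoc _ _ _ ⟨
      factorial (suc n) * δ n m ∎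

    -- j! [xʲ] p = (Dʲ p)(0), and Dʲ = ψ(φ(D))ʲ = Σₘ (ψʲ)ₘ φ(D)ᵐ.
    poweroid-coeff : ∀ ψ → ψ ∘ˢ series φ ≈ˢ t →
      ∀ n j → factorial j * coeff (p n) j ≈ factorial n * (ψ ^ˢ j) n
    poweroid-coeff ψ ψ∘φ≈t n j = begin
      factorial j * coeff (p n) j
        ≈⟨ ⟪δ⟫ j (p n) ⟨
      ⟪ δ j , p n ⟫
        ≈⟨ ⟪⟫-congˡ (p n) (λ k → trans (sym (t^ˢ≈δ j k))
             (trans (sym (^ˢ-cong ψ∘φ≈t j k))
                    (sym (∘ˢ-^ˢ (series φ) (constant φ) ψ j k)))) ⟩
      ⟪ (ψ ^ˢ j) ∘ˢ series φ , p n ⟫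
        ≈⟨ Σ<-cong N (λ k k<N → *-congʳ {factorial k * coeff (p n) k}
             (∘ˢ-bound (series φ) (constant φ) (ψ ^ˢ j) (≤-trans k<N (m≤m+n N (suc n))))) ⟩
      Σ< N (λ k → Σ< M (λ m → (ψ ^ˢ j) m * (series φ ^ˢ m) k) * (factorial k * coeff (p n) k))
        ≈⟨ Σ<-interchange N M (ψ ^ˢ j) (series φ ^ˢ_) (λ k → factorial k * coeff (p n) k) ⟩
      Σ< M (λ m → (ψ ^ˢ j) m * ⟪ series φ ^ˢ m , p n ⟫)
        ≈⟨ Σ<-cong M (λ m _ → trans (*-congˡ {(ψ ^ˢ j) m} (⟪φ^,p⟫ m n))
             (x∙yz≈yx∙z ((ψ ^ˢ j) m) (factorial n) (δ n m))) ⟩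
      Σ< M (λ m → factorial n * (ψ ^ˢ j) m * δ n m)
        ≈⟨ Σ<-δ (λ m → factorial n * (ψ ^ˢ j) m) (m≤n+m (suc n) N) ⟩
      factorial n * (ψ ^ˢ j) n ∎
      where
      N = length (p n)
      -- The cutoff has to exceed every degree k < N of p n, for the expansion in powers of φ, and
      -- also n, so that `δ n` finds its index.
      M = N ℕ.+ suc n

    -- The generating function Σₙ pₙ(x) tⁿ/n! = e^{xψ(t)}, read off in degree n.
    poweroid-e^x : ∀ ψ → ψ 0 ≈ 0# → ψ ∘ˢ series φ ≈ˢ t →
      ∀ n j → coeff (p n) j ≈ factorial n * coeff ((e^x ψ) n) j
    poweroid-e^x ψ ψ₀≈0 ψ∘φ≈t n j = begin
      coeff (p n) j
        ≈⟨ *-identityˡ _ ⟨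
      1# * coeff (p n) j
        ≈⟨ *-congʳ (factorial*1/! j) ⟨
      factorial j * 1/ j ! * coeff (p n) j
        ≈⟨ xy∙z≈y∙xz (factorial j) (1/ j !) _ ⟩
      1/ j ! * (factorial j * coeff (p n) j)
        ≈⟨ *-congˡ (poweroid-coeff ψ ψ∘φ≈t n j) ⟩
      1/ j ! * (factorial n * (ψ ^ˢ j) n)
        ≈⟨ x∙yz≈y∙xz (1/ j !) (factorial n) _ ⟩
      factorial n * (1/ j ! * (ψ ^ˢ j) n)
        ≈⟨ *-congˡ (coeff-e^x ψ ψ₀≈0 n j) ⟨
      factorial n * coeff ((e^x ψ) n) j ∎

  -- Rebracketing brings ψ₂ next to φ₂; they cancel and leave ψ₁ ∘ φ₁.
  ∘ˢ-inverseˡ : ∀ (φ₁ φ₂ : DeltaSeries) ψ₁ ψ₂ → ψ₂ 0 ≈ 0# →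
    ψ₁ ∘ˢ series φ₁ ≈ˢ t → ψ₂ ∘ˢ series φ₂ ≈ˢ t →
    (ψ₁ ∘ˢ ψ₂) ∘ˢ series (φ₂ ∘ᵟ φ₁) ≈ˢ t
  ∘ˢ-inverseˡ φ₁ φ₂ ψ₁ ψ₂ ψ₂₀≈0 ψ₁∘φ₁≈t ψ₂∘φ₂≈t n = begin
    ((ψ₁ ∘ˢ ψ₂) ∘ˢ (f₂ ∘ˢ f₁)) n
      ≈⟨ ∘ˢ-assoc ψ₁ ψ₂ (f₂ ∘ˢ f₁) ψ₂₀≈0 (constant (φ₂ ∘ᵟ φ₁)) n ⟩
    (ψ₁ ∘ˢ (ψ₂ ∘ˢ (f₂ ∘ˢ f₁))) n
      ≈⟨ ∘ˢ-cong {ψ₁} (λ _ → refl) (λ m → begin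
           (ψ₂ ∘ˢ (f₂ ∘ˢ f₁)) m ≈⟨ ∘ˢ-assoc ψ₂ f₂ f₁ (constant φ₂) (constant φ₁) m ⟨
           ((ψ₂ ∘ˢ f₂) ∘ˢ f₁) m ≈⟨ ∘ˢ-cong {g = f₁} ψ₂∘φ₂≈t (λ _ → refl) m ⟩
           (t ∘ˢ f₁) m          ≈⟨ t-∘ˢ f₁ (constant φ₁) m ⟩
           f₁ m                 ∎) n ⟩
    (ψ₁ ∘ˢ f₁) n
      ≈⟨ ψ₁∘φ₁≈t n ⟩
    t n ∎
    where
    f₁ = series φ₁
    f₂ = series φ₂

mainTheorem4 : ∀ {c ℓ} (K : CommutativeRing c ℓ) (inv : PositiveIntegersInvertible K) →
    let open Poweroids K inv in
    (φ₁ φ₂ : DeltaSeries) (ψ₁ ψ₂ : Series) →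
    IsCompositionalInverse φ₁ ψ₁ →
    IsCompositionalInverse φ₂ ψ₂ →
    (p₁ p₂ p₁₂ : ℕ → Poly) →
    IsPoweroids φ₁ p₁ →
    IsPoweroids φ₂ p₂ →
    IsPoweroids (φ₂ ∘ᵟ φ₁) p₁₂ →
    ((e^x (ψ₁ ∘ˢ ψ₂)) K[x].≈ˢ (e^x ψ₁ e^0· ψ₂)) ×
    (∀ n →
    (p₁₂ n ≈ᵖ (e^x ψ₁ e^0· ψ₂) at-0 (z^ n)) ×
    ((e^x ψ₁ e^0· ψ₂) at-0 (z^ n) ≈ᵖ (e^x ψ₁) at-0 (p₂ n)) ×
    ((e^x ψ₁) at-0 (p₂ n) ≈ᵖ replacePowers (p₂ n) p₁))
mainTheorem4 K inv φ₁ φ₂ ψ₁ ψ₂ inv₁ inv₂ p₁ p₂ p₁₂ isP₁ isP₂ isP₁₂ =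
  composed , λ n → composite n , exponential n , umbral n
  where
  open CommutativeRing K
  open Poweroids K inv
  open SeriesProperties commutativeSemiring
  open PoweroidProperties K inv
  open CommutativeSemigroupProperties *-commutativeSemigroup using (x∙yz≈y∙xz; x∙yz≈z∙yx)
  open SetoidReasoning setoid
  open IsCompositionalInverse inv₁ using () renaming (constant-zero to ψ₁₀≈0; inverseˡ to ψ₁∘φ₁≈t)
  open IsCompositionalInverse inv₂ using () renaming (constant-zero to ψ₂₀≈0; inverseˡ to ψ₂∘φ₂≈t)

  E : ℕ → Series
  E j ν = coeff ((e^x ψ₁) ν) j

  composed : (e^x (ψ₁ ∘ˢ ψ₂)) K[x].≈ˢ (e^x ψ₁ e^0· ψ₂)
  composed = e^x-∘ˢ ψ₁ ψ₂ ψ₁₀≈0 ψ₂₀≈0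

  composite : ∀ n → p₁₂ n ≈ᵖ (e^x ψ₁ e^0· ψ₂) at-0 (z^ n)
  composite n j = begin
    coeff (p₁₂ n) j
      ≈⟨ poweroid-e^x (φ₂ ∘ᵟ φ₁) p₁₂ isP₁₂ (ψ₁ ∘ˢ ψ₂) (∘ˢ-constant ψ₁ ψ₂ ψ₁₀≈0)
           (∘ˢ-inverseˡ φ₁ φ₂ ψ₁ ψ₂ ψ₂₀≈0 ψ₁∘φ₁≈t ψ₂∘φ₂≈t) n j ⟩
    factorial n * coeff ((e^x (ψ₁ ∘ˢ ψ₂)) n) j
      ≈⟨ *-congˡ (composed n j) ⟩
    factorial n * coeff ((e^x ψ₁ e^0· ψ₂) n) j
      ≈⟨ coeff-at-0-z^ (e^x ψ₁ e^0· ψ₂) n j ⟨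
    coeff ((e^x ψ₁ e^0· ψ₂) at-0 (z^ n)) j ∎

  -- Both sides are sums of `E j ν` against weights: n! (ψ₂^ν)ₙ from the substitution and ν! [x^ν]
  -- p₂ n from the pairing. `p₂-coeff` identifies the weights.
  exponential : ∀ n → (e^x ψ₁ e^0· ψ₂) at-0 (z^ n) ≈ᵖ (e^x ψ₁) at-0 (p₂ n)
  exponential n j = begin
    coeff ((e^x ψ₁ e^0· ψ₂) at-0 (z^ n)) j
      ≈⟨ coeff-at-0-z^ (e^x ψ₁ e^0· ψ₂) n j ⟩
    factorial n * coeff ((e^x ψ₁ e^0· ψ₂) n) j
      ≈⟨ *-congˡ (coeff-e^x-e^0 ψ₁ ψ₂ n j) ⟩
    factorial n * Σ< (suc n) (λ ν → E j ν * (ψ₂ ^ˢ ν) n)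
      ≈⟨ *-Σ< (suc n) (factorial n) (λ ν → E j ν * (ψ₂ ^ˢ ν) n) ⟩
    Σ< (suc n) (λ ν → factorial n * (E j ν * (ψ₂ ^ˢ ν) n))
      ≈⟨ Σ<-cong (suc n) (λ ν _ →
           trans (x∙yz≈y∙xz (factorial n) (E j ν) _) (*-congˡ (sym (p₂-coeff ν)))) ⟩
    Σ< (suc n) (λ ν → E j ν * (factorial ν * coeff (p₂ n) ν))
      ≈⟨ Σ<-agree (suc n) (length (p₂ n)) (λ ν → E j ν * (factorial ν * coeff (p₂ n) ν))
           (λ ν n<ν → trans (*-congˡ (trans (p₂-coeff ν)
              (trans (*-congˡ (^ˢ-vanish ψ₂ ψ₂₀≈0 n<ν)) (zeroʳ _)))) (zeroʳ _))
           (⟪⟫-beyond (E j) (p₂ n)) ⟩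
    ⟪ E j , p₂ n ⟫
      ≈⟨ coeff-at-0 (e^x ψ₁) (p₂ n) j ⟨
    coeff ((e^x ψ₁) at-0 (p₂ n)) j ∎
    where
    open RawSemiringOps seriesRawSemiring using () renaming (_^_ to _^ˢ_)
    p₂-coeff : ∀ ν → factorial ν * coeff (p₂ n) ν ≈ factorial n * (ψ₂ ^ˢ ν) n
    p₂-coeff = poweroid-coeff φ₂ p₂ isP₂ ψ₂ ψ₂∘φ₂≈t n

  -- The factor ν! of the pairing turns the coefficient of e^{xψ₁} at t^ν into p₁ ν, so e^{xη₁}
  -- sends z^ν to p₁ ν and linearity does the rest.
  umbral : ∀ n → (e^x ψ₁) at-0 (p₂ n) ≈ᵖ replacePowers (p₂ n) p₁
  umbral n j = begin
    coeff ((e^x ψ₁) at-0 (p₂ n)) j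
      ≈⟨ coeff-at-0 (e^x ψ₁) (p₂ n) j ⟩
    ⟪ E j , p₂ n ⟫
      ≈⟨ Σ<-cong (length (p₂ n)) (λ ν _ →
           trans (x∙yz≈z∙yx (E j ν) (factorial ν) (coeff (p₂ n) ν))
                 (*-congˡ (sym (poweroid-e^x φ₁ p₁ isP₁ ψ₁ ψ₁₀≈0 ψ₁∘φ₁≈t ν j)))) ⟩
    Σ< (length (p₂ n)) (λ ν → coeff (p₂ n) ν * coeff (p₁ ν) j)
      ≈⟨ coeff-replacePowers (p₂ n) p₁ j ⟨
    coeff (replacePowers (p₂ n) p₁) j ∎
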